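{- Suppose $\mathcal D=(\mathcal P,\mathcal B,\mathcal I)$ is a non-trivial $2$-design and $G\le\mathrm{Aut}(\mathcal D)$. Consider the conditions (a) $G^{\mathcal P}$ is $2$-transitive; (b) either $G^{\mathcal B}$ is $2$-transitive, or $G^{\mathcal B}$ is transitive of rank $3$ and $\mathcal D$ has non-intersecting blocks; (c) $G_p$ has two orbits on $\mathcal B$, for any $p\in\mathcal P$; (d) $G_b$ has two orbits on $\mathcal P$, for any $b\in\mathcal B$. Then: (A) The following are equivalent: (i) $\mathcal D$ is $G$-pairwise transitive; (ii) conditions (a), (b), (c) all hold; (iii) conditions (a), (b), (d) all hold. (B) Assume in addition that $\mathcal D$ is symmetric. Then $\mathcal D$ is $G$-pairwise transitive if and only if $G^{\mathcal P}$ is $2$-transitive.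
   Context: A design $\mathcal D=(\mathcal P,\mathcal B,\mathcal I)$ consists of finite sets $\mathcal P$ (points), $\mathcal B$ (blocks) and an incidence relation $\mathcal I\subseteq\mathcal P\times\mathcal B$. It is a $2$-$(v,k,\lambda)$ design (or $2$-design) if $|\mathcal P|=v$, each block is incident with exactly $k$ points, and each pair of distinct points is incident with exactly $\lambda$ common blocks. It is non-trivial if $2<k<v$, and symmetric if $|\mathcal B|=v$. An automorphism is a permutation of $\mathcal P\cup\mathcal B$ leaving $\mathcal P$ and $\mathcal B$ invariant setwise and preserving incidence; $\mathrm{Aut}(\mathcal D)$ is the group of all automorphisms. Two blocks are intersecting if some point is incident with both. For $G\le\mathrm{Aut}(\mathcal D)$, the $2$-design $\mathcal D$ is $G$-pairwise transitive if $G$ is transitive on each of the following five (possibly empty) sets of ordered pairs: pairs of distinct points, incident point-block pairs, non-incident point-block pairs, pairs of distinct intersecting blocks, pairs of non-intersecting blocks. $G^{\mathcal P}$ and $G^{\mathcal B}$ are the permutation groups induced by $G$ on $\mathcal P$ and $\mathcal B$; $G_x$ is the stabiliser of $x$. A transitive permutation group has rank $n$ if a point stabiliser has exactly $n$ orbits. -}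

module Defs where

open import Algebra.Bundles using (Group)
open import Data.Fin.Base using (Fin)
open import Data.Fin.Permutation as Perm using (Permutation′; _⟨$⟩ʳ_; _⟨$⟩ˡ_; _∘ₚ_)
open import Data.Nat.Base using (ℕ; _<_)
open import Data.Product.Base using (_×_; _,_; ∃-syntax)
open import Data.Sum.Base using (_⊎_)
open import Data.Vec.Base using (allFin; count)
open import Function.Bundles using (_⇔_; mk⇔; Equivalence)
open import Function.Construct.Composition using (_⇔-∘_)
open import Function.Construct.Identity using (⇔-id)
open import Level using (Level; 0ℓ; _⊔_)
open import Relation.Binary.Core using (Rel; REL)
open import Relation.Binary.Definitions using () renaming (Decidable to Decidable₂)
open import Relation.Binary.PropositionalEquality
  using (_≡_; _≢_; refl; sym; trans; cong; subst₂)
open import Relation.Nullary.Decidable.Core using (_×-dec_)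
open import Relation.Nullary.Negation.Core using (¬_)
open import Relation.Unary using (Pred; Decidable; _∈_)

private
  variable
    g ℓ r : Level
    n : ℕ

-- Cardinality of a decidable subset of Fin n.
#_ : {P : Pred (Fin n) ℓ} → Decidable P → ℕ
#_ {n = n} P? = count P? (allFin n)

record IsSubgroup (𝒢 : Group g ℓ) (H : Pred (Group.Carrier 𝒢) r) : Set (g ⊔ ℓ ⊔ r) where
  open Group 𝒢
  field
    resp-≈    : ∀ {x y} → x ≈ y → x ∈ H → y ∈ H
    ε-closed  : ε ∈ H
    ∙-closed  : ∀ {x y} → x ∈ H → y ∈ H → x ∙ y ∈ H
    ⁻¹-closed : ∀ {x} → x ∈ H → x ⁻¹ ∈ H

-- Permutation groups on Fin n are given as predicates on permutations.  The
-- notions below make sense for any predicate, but are only ever applied to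
-- groups.
module PermutationGroup {n : ℕ} (H : Pred (Permutation′ n) ℓ) where

  SameOrbit : Rel (Fin n) ℓ
  SameOrbit x y = ∃[ π ] π ∈ H × π ⟨$⟩ʳ x ≡ y

  -- There are exactly m orbits: rep is a transversal of the orbits.
  record HasOrbits (m : ℕ) : Set ℓ where
    field
      rep          : Fin m → Fin n
      rep-distinct : ∀ {i j} → i ≢ j → ¬ SameOrbit (rep i) (rep j)
      rep-covers   : ∀ x → ∃[ i ] SameOrbit (rep i) x

  Transitive : Set ℓ
  Transitive = ∀ x y → SameOrbit x y

  2-Transitive : Set ℓ
  2-Transitive = ∀ {x y x′ y′} → x ≢ y → x′ ≢ y′ →
    ∃[ π ] π ∈ H × π ⟨$⟩ʳ x ≡ x′ × π ⟨$⟩ʳ y ≡ y′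

  PointStabiliser : Fin n → Pred (Permutation′ n) ℓ
  PointStabiliser x π = π ∈ H × π ⟨$⟩ʳ x ≡ x

open PermutationGroup public

HasRank : Pred (Permutation′ n) ℓ → ℕ → Set ℓ
HasRank H m = Transitive H × (∀ x → HasOrbits (PointStabiliser H x) m)

-- The finite sets of points and blocks are taken to be Fin #points and
-- Fin #blocks.  Distinct blocks may be incident with the same points.
record Design : Set₁ where
  infix 4 _I_ _I?_
  field
    #points : ℕ
    #blocks : ℕ
    _I_     : REL (Fin #points) (Fin #blocks) 0ℓ
    _I?_    : Decidable₂ _I_

  Point Block : Set
  Point = Fin #points
  Block = Fin #blocks

  Intersecting : Rel Block 0ℓ
  Intersecting b c = ∃[ p ] p I b × p I c

-- As usual λ is required to be positive.  Otherwise the structure without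
-- blocks would be a 2-(v,k,0) design for every k; when k ≥ 2 this is the only
-- case excluded.
record Is2Design (D : Design) (v k λ′ : ℕ) : Set where
  open Design D
  field
    λ-positive     : 0 < λ′
    points-count   : #points ≡ v
    block-size     : ∀ b → # (λ p → p I? b) ≡ k
    blocks-through : ∀ {p q} → p ≢ q → # (λ b → (p I? b) ×-dec (q I? b)) ≡ λ′

NonTrivial : (v k : ℕ) → Set
NonTrivial v k = 2 < k × k < v

Symmetric : Design → ℕ → Set
Symmetric D v = Design.#blocks D ≡ v

-- A permutation of the disjoint union of points and blocks leaving both parts
-- invariant is a pair of permutations, one of each part.
record Automorphism (D : Design) : Set where
  open Design D
  field
    onPoints  : Permutation′ #points
    onBlocks  : Permutation′ #blocks
    preserves : ∀ p b → p I b ⇔ (onPoints ⟨$⟩ʳ p) I (onBlocks ⟨$⟩ʳ b)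

  actP : Point → Point
  actP p = onPoints ⟨$⟩ʳ p

  actB : Block → Block
  actB b = onBlocks ⟨$⟩ʳ b

-- The product α ∙ β applies β first.
Aut : Design → Group 0ℓ 0ℓ
Aut D = record
  { Carrier = Automorphism D
  ; _≈_     = λ α β → onPoints α Perm.≈ onPoints β × onBlocks α Perm.≈ onBlocks β
  ; _∙_     = λ α β → record
    { onPoints  = onPoints β ∘ₚ onPoints α
    ; onBlocks  = onBlocks β ∘ₚ onBlocks α
    ; preserves = λ p b → preserves α (actP β p) (actB β b) ⇔-∘ preserves β p b
    }
  ; ε       = record
    { onPoints  = Perm.id
    ; onBlocks  = Perm.id
    ; preserves = λ p b → ⇔-id (p I b)
    }
  ; _⁻¹     = λ α → record
    { onPoints  = Perm.flip (onPoints α)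
    ; onBlocks  = Perm.flip (onBlocks α)
    ; preserves = λ p b →
        let e   = preserves α (onPoints α ⟨$⟩ˡ p) (onBlocks α ⟨$⟩ˡ b)
            αp≡ = Perm.inverseʳ (onPoints α) {p}
            αb≡ = Perm.inverseʳ (onBlocks α) {b}
        in mk⇔
          (λ pIb → Equivalence.from e (subst₂ _I_ (sym αp≡) (sym αb≡) pIb))
          (λ pIb → subst₂ _I_ αp≡ αb≡ (Equivalence.to e pIb))
    }
  ; isGroup = record
    { isMonoid = record
      { isSemigroup = record
        { isMagma = record
          { isEquivalence = record
            { refl  = (λ _ → refl) , (λ _ → refl)
            ; sym   = λ (e , f) → (λ i → sym (e i)) , (λ i → sym (f i))
            ; trans = λ (e , f) (e′ , f′) →
                (λ i → trans (e i) (e′ i)) , (λ i → trans (f i) (f′ i))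
            }
          ; ∙-cong = λ {α} {_} {_} {δ} (e , f) (e′ , f′) →
              (λ i → trans (cong (actP α) (e′ i)) (e (actP δ i))) ,
              (λ i → trans (cong (actB α) (f′ i)) (f (actB δ i)))
          }
        ; assoc = λ _ _ _ → (λ _ → refl) , (λ _ → refl)
        }
      ; identity = (λ _ → (λ _ → refl) , (λ _ → refl))
                 , (λ _ → (λ _ → refl) , (λ _ → refl))
      }
    ; inverse = (λ α → (λ _ → Perm.inverseˡ (onPoints α)) , (λ _ → Perm.inverseˡ (onBlocks α)))
              , (λ α → (λ _ → Perm.inverseʳ (onPoints α)) , (λ _ → Perm.inverseʳ (onBlocks α)))
    ; ⁻¹-cong = λ {α} {β} (e , f) →
        flip-cong (onPoints α) (onPoints β) e , flip-cong (onBlocks α) (onBlocks β) f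
    }
  }
  where
  open Design D
  open Automorphism
  flip-cong : ∀ {m} (π ρ : Permutation′ m) → π Perm.≈ ρ → Perm.flip π Perm.≈ Perm.flip ρ
  flip-cong π ρ e i =
    trans (sym (Perm.inverseˡ ρ))
      (cong (ρ ⟨$⟩ˡ_) (trans (sym (e (π ⟨$⟩ˡ i))) (Perm.inverseʳ π)))

module _ (D : Design) (G : Pred (Automorphism D) ℓ) where
  open Design D
  open Automorphism

  inducedOnPoints : Pred (Permutation′ #points) ℓ
  inducedOnPoints π = ∃[ α ] α ∈ G × onPoints α Perm.≈ π

  inducedOnBlocks : Pred (Permutation′ #blocks) ℓ
  inducedOnBlocks π = ∃[ α ] α ∈ G × onBlocks α Perm.≈ π

  stabiliserOfPoint : Point → Pred (Automorphism D) ℓ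
  stabiliserOfPoint p α = α ∈ G × actP α p ≡ p

  stabiliserOfBlock : Block → Pred (Automorphism D) ℓ
  stabiliserOfBlock b α = α ∈ G × actB α b ≡ b

  -- G is transitive on the set of pairs (x , y) with R x y.
  TransitiveOnPairs : {X Y : Set} →
    (Automorphism D → X → X) → (Automorphism D → Y → Y) → REL X Y 0ℓ → Set ℓ
  TransitiveOnPairs actX actY R = ∀ {x y x′ y′} → R x y → R x′ y′ →
    ∃[ α ] α ∈ G × actX α x ≡ x′ × actY α y ≡ y′

  record PairwiseTransitive : Set ℓ where
    field
      distinctPoints        : TransitiveOnPairs actP actP _≢_
      incidentPairs         : TransitiveOnPairs actP actB _I_
      nonIncidentPairs      : TransitiveOnPairs actP actB (λ p b → ¬ p I b)
      intersectingBlocks    : TransitiveOnPairs actB actB (λ b c → b ≢ c × Intersecting b c)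
      nonIntersectingBlocks : TransitiveOnPairs actB actB (λ b c → ¬ Intersecting b c)

  ConditionA : Set ℓ
  ConditionA = 2-Transitive inducedOnPoints

  ConditionB : Set ℓ
  ConditionB = 2-Transitive inducedOnBlocks
    ⊎ (HasRank inducedOnBlocks 3 × ∃[ b ] ∃[ c ] ¬ Intersecting b c)

module _ (D : Design) (G : Pred (Automorphism D) ℓ) where
  open Design D

  ConditionC : Set ℓ
  ConditionC = ∀ p → HasOrbits (inducedOnBlocks D (stabiliserOfPoint D G p)) 2

  ConditionD : Set ℓ
  ConditionD = ∀ b → HasOrbits (inducedOnPoints D (stabiliserOfBlock D G b)) 2

{-# OPTIONS --safe #-}
module Submission where

-- Part (A): the relations in question split the pairs into nonempty invariant
-- classes; G is transitive on each class if and only if a stabiliser has as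
-- many orbits as there are classes.
--
-- Part (B): let N be the incidence matrix.  The squared deviations
-- (|b ∩ c| - λ)² sum over c to (k - λ)², the contribution of c = b, so distinct
-- blocks meet in λ points and Nᵗ N = (k - λ) I + λ J.  For an invariant function
-- f on P × B, the invariant function f Nᵗ on P × P is α I + β J by
-- 2-transitivity, and multiplication by N recovers f as a combination of N
-- and J: f is constant on flags and on antiflags.  For f invariant on B × B the
-- same applies to N f, so f is a combination of I and J.  Choosing f to separate
-- orbits gives the transitivity statements.

open import Defs
open import Algebra.Bundles using (Group)
open import Data.Bool.Base using (true; false; if_then_else_)
open import Data.Fin.Base using (Fin; zero; suc; toℕ; combine)
open import Data.Fin.Patterns using (0F; 1F; 2F)
open import Data.Fin.Permutation as Perm using (Permutation′; _⟨$⟩ʳ_)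
open import Data.Fin.Properties using
  (_≟_; any?; suc-injective; punchOut-injective; <⇒notInjective; toℕ-injective; combine-injective)
open import Data.List.Base using (List; []; _∷_; allFin; cartesianProduct)
open import Data.List.Membership.Propositional using () renaming (_∈_ to _∈ˡ_)
open import Data.List.Membership.Propositional.Properties using (∈-allFin; ∈-cartesianProduct⁺)
open import Data.List.Relation.Unary.Any using (here; there)
open import Data.Nat.Base
  using (ℕ; zero; suc; _+_; _*_; _∸_; _<_; _≤_; z≤n; z<s; s≤s; ∣_-_∣; >-nonZero)
import Data.Nat.Properties as ℕ
open import Data.Nat.Tactic.RingSolver using (solve-∀)
open import Data.Product.Base using (_×_; _,_; proj₁; proj₂; ∃; ∃₂; Σ-syntax; ∃-syntax)
open import Data.Product.Properties using (×-≡,≡→≡)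
open import Data.Sum.Base using (inj₁; inj₂)
open import Data.Vec.Base using (count; tabulate)
open import Function.Base using (_∘_; flip)
open import Function.Bundles using (_⇔_; mk⇔; Equivalence)
open import Level using (Level; 0ℓ)
open import Relation.Binary.Core using (Rel; REL)
open import Relation.Binary.Structures using (IsEquivalence)
open import Relation.Binary.PropositionalEquality
  using (_≡_; _≢_; refl; sym; trans; cong; cong₂; subst; subst₂; ≢-sym; module ≡-Reasoning)
open import Relation.Nullary.Decidable.Core
  using (Dec; yes; no; does; _×-dec_; ¬?; decidable-stable)
open import Relation.Nullary.Decidable using (dec-true; dec-false)
open import Relation.Nullary.Negation using (¬_; contradiction)
open import Relation.Unary using (Pred; Decidable; _∈_)

open import Algebra.Properties.Semiring.Sum ℕ.+-*-semiring
  using (sum; sum-syntax; sum-cong-≗; ∑-distrib-+; ∑-comm; ∑-permute; *-distribˡ-sum; *-distribʳ-sum)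

private
  variable
    ℓ ℓ′ : Level
    m n : ℕ

-- Finite sums

sum-const : ∀ n c → ∑[ i < n ] c ≡ n * c
sum-const zero    c = refl
sum-const (suc n) c = cong (c +_) (sum-const n c)

term≤sum : (f : Fin n → ℕ) (i : Fin n) → f i ≤ sum f
term≤sum f zero    = ℕ.m≤m+n _ _
term≤sum f (suc i) = ℕ.≤-trans (term≤sum (f ∘ suc) i) (ℕ.m≤n+m _ _)

twoTerms≤sum : (f : Fin n → ℕ) {i j : Fin n} → j ≢ i → f i + f j ≤ sum f
twoTerms≤sum f {zero}  {zero}  j≢i = contradiction refl j≢i
twoTerms≤sum f {zero}  {suc j} j≢i = ℕ.+-monoʳ-≤ (f zero) (term≤sum (f ∘ suc) j)
twoTerms≤sum f {suc i} {zero}  j≢i =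
  ℕ.≤-trans (ℕ.≤-reflexive (ℕ.+-comm (f (suc i)) _)) (ℕ.+-monoʳ-≤ (f zero) (term≤sum (f ∘ suc) i))
twoTerms≤sum f {suc i} {suc j} j≢i =
  ℕ.≤-trans (twoTerms≤sum (f ∘ suc) (j≢i ∘ cong suc)) (ℕ.m≤n+m _ _)

sum≡term⇒others≡0 : (f : Fin n → ℕ) {i j : Fin n} → sum f ≡ f i → j ≢ i → f j ≡ 0
sum≡term⇒others≡0 f {i} {j} eq j≢i = ℕ.n≤0⇒n≡0
  (ℕ.+-cancelˡ-≤ (f i) _ _ (begin
    f i + f j ≤⟨ twoTerms≤sum f j≢i ⟩
    sum f     ≡⟨ eq ⟩
    f i       ≡⟨ ℕ.+-identityʳ (f i) ⟨
    f i + 0   ∎))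
  where open ℕ.≤-Reasoning

-- The correction terms stand in for subtractions: the left sum is
-- (f i ∸ c) * g i + c * sum g.
sum-constantOff : (f g : Fin n → ℕ) (i : Fin n) {c : ℕ} → (∀ j → j ≢ i → f j ≡ c) →
  ∑[ j < n ] (f j * g j) + c * g i ≡ f i * g i + c * sum g
sum-constantOff {suc n} f g zero {c} off = begin
  f zero * g zero + ∑[ j < n ] (f (suc j) * g (suc j)) + c * g zero
    ≡⟨ cong (λ s → f zero * g zero + s + c * g zero)
         (trans (sum-cong-≗ (λ j → cong (_* g (suc j)) (off (suc j) λ ())))
                (sym (*-distribˡ-sum c (g ∘ suc)))) ⟩
  f zero * g zero + c * sum (g ∘ suc) + c * g zero
    ≡⟨ rearranged (f zero) (g zero) c (sum (g ∘ suc)) ⟩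
  f zero * g zero + c * (g zero + sum (g ∘ suc)) ∎
  where
  open ≡-Reasoning
  rearranged : ∀ a x c s → a * x + c * s + c * x ≡ a * x + c * (x + s)
  rearranged = solve-∀
sum-constantOff {suc n} f g (suc i) {c} off = begin
  f zero * g zero + s + c * g (suc i)
    ≡⟨ cong (λ a → a * g zero + s + c * g (suc i)) (off zero λ ()) ⟩
  c * g zero + s + c * g (suc i)
    ≡⟨ ℕ.+-assoc (c * g zero) s _ ⟩
  c * g zero + (s + c * g (suc i))
    ≡⟨ cong (c * g zero +_) (sum-constantOff (f ∘ suc) (g ∘ suc) i
         (λ j j≢i → off (suc j) (j≢i ∘ suc-injective))) ⟩
  c * g zero + (f (suc i) * g (suc i) + c * sum (g ∘ suc))
    ≡⟨ rearranged c (g zero) (f (suc i) * g (suc i)) (sum (g ∘ suc)) ⟩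
  f (suc i) * g (suc i) + c * (g zero + sum (g ∘ suc)) ∎
  where
  open ≡-Reasoning
  s = ∑[ j < n ] (f (suc j) * g (suc j))
  rearranged : ∀ c x a t → c * x + (a + c * t) ≡ a + c * (x + t)
  rearranged = solve-∀

indicator : {P : Set ℓ} → Dec P → ℕ
indicator P? = if does P? then 1 else 0

indicator-true : {P : Set ℓ} (P? : Dec P) → P → indicator P? ≡ 1
indicator-true P? p rewrite dec-true P? p = refl

indicator-false : {P : Set ℓ} (P? : Dec P) → ¬ P → indicator P? ≡ 0
indicator-false P? ¬p rewrite dec-false P? ¬p = refl

indicator-cong : {P : Set ℓ} {Q : Set ℓ′} (P? : Dec P) (Q? : Dec Q) →
  P ⇔ Q → indicator P? ≡ indicator Q?
indicator-cong P? (yes q) e = indicator-true P? (Equivalence.from e q)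
indicator-cong P? (no ¬q) e = indicator-false P? (¬q ∘ Equivalence.to e)

indicator-× : {P : Set ℓ} {Q : Set ℓ′} (P? : Dec P) (Q? : Dec Q) →
  indicator (P? ×-dec Q?) ≡ indicator P? * indicator Q?
indicator-× P? Q? with does P? | does Q?
... | true  | true  = refl
... | true  | false = refl
... | false | _     = refl

count-tabulate : {A : Set} {P : Pred A ℓ} (P? : Decidable P) (f : Fin n → A) →
  count P? (tabulate f) ≡ ∑[ i < n ] indicator (P? (f i))
count-tabulate {n = zero}  P? f = refl
count-tabulate {n = suc n} P? f with does (P? (f zero))
... | true  = cong suc (count-tabulate P? (f ∘ suc))
... | false = count-tabulate P? (f ∘ suc)

#≡sum : {P : Pred (Fin n) ℓ} (P? : Decidable P) → # P? ≡ ∑[ i < n ] indicator (P? i)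
#≡sum P? = count-tabulate P? (λ i → i)

∣m-n∣²+2mn : ∀ m n → ∣ m - n ∣ * ∣ m - n ∣ + 2 * m * n ≡ m * m + n * n
∣m-n∣²+2mn zero    n       = ℕ.+-identityʳ (n * n)
∣m-n∣²+2mn (suc m) zero    = cong (suc m * suc m +_) (ℕ.*-zeroʳ (2 * suc m))
∣m-n∣²+2mn (suc m) (suc n) = begin
  d * d + 2 * suc m * suc n         ≡⟨ shifted (d * d) m n ⟩
  (d * d + 2 * m * n) + 2 * (m + n + 1)       ≡⟨ cong (_+ 2 * (m + n + 1)) (∣m-n∣²+2mn m n) ⟩
  m * m + n * n + 2 * (m + n + 1)   ≡⟨ squares m n ⟩
  suc m * suc m + suc n * suc n     ∎
  where
  open ≡-Reasoning
  d = ∣ m - n ∣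
  shifted : ∀ s m n → s + 2 * suc m * suc n ≡ (s + 2 * m * n) + 2 * (m + n + 1)
  shifted = solve-∀
  squares : ∀ m n → m * m + n * n + 2 * (m + n + 1) ≡ suc m * suc m + suc n * suc n
  squares = solve-∀

-- Square 0-1 matrices with constant row inner products

module SquareIncidence {v w k λ′ : ℕ} (N : Fin v → Fin w → ℕ)
  (idempotent   : ∀ p b → N p b * N p b ≡ N p b)
  (column-sum   : ∀ b → ∑[ p < v ] N p b ≡ k)
  (row-products : ∀ {p q} → p ≢ q → ∑[ b < w ] (N p b * N q b) ≡ λ′)
  (square : w ≡ v) (1<k : 1 < k) (k<v : k < v)
  where

  open ≡-Reasoning

  rowProduct : Fin v → Fin v → ℕ
  rowProduct p q = ∑[ b < w ] (N p b * N q b)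

  columnProduct : Fin w → Fin w → ℕ
  columnProduct b c = ∑[ p < v ] (N p b * N p c)

  rowSum : Fin v → ℕ
  rowSum p = ∑[ b < w ] N p b

  rowProduct-diagonal : ∀ p → rowProduct p p ≡ rowSum p
  rowProduct-diagonal p = sum-cong-≗ (idempotent p)

  columnProduct-diagonal : ∀ b → columnProduct b b ≡ k
  columnProduct-diagonal b = trans (sum-cong-≗ (λ p → idempotent p b)) (column-sum b)

  rowSum-equation : ∀ p → k * rowSum p + λ′ ≡ rowSum p + v * λ′
  rowSum-equation p = begin
    k * rowSum p + λ′
      ≡⟨ cong₂ _+_ k*rowSum (sym (ℕ.*-identityʳ λ′)) ⟩
    ∑[ q < v ] (rowProduct p q * 1) + λ′ * 1
      ≡⟨ sum-constantOff (rowProduct p) (λ _ → 1) p (λ q q≢p → row-products (≢-sym q≢p)) ⟩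
    rowProduct p p * 1 + λ′ * ∑[ q < v ] 1
      ≡⟨ cong₂ _+_ (trans (ℕ.*-identityʳ _) (rowProduct-diagonal p))
                   (trans (cong (λ′ *_) (trans (sum-const v 1) (ℕ.*-identityʳ v))) (ℕ.*-comm λ′ v)) ⟩
    rowSum p + v * λ′ ∎
    where
    k*rowSum : k * rowSum p ≡ ∑[ q < v ] (rowProduct p q * 1)
    k*rowSum = begin
      k * rowSum p                             ≡⟨ ℕ.*-comm k _ ⟩
      rowSum p * k                             ≡⟨ *-distribʳ-sum k (N p) ⟩
      ∑[ b < w ] (N p b * k)
        ≡⟨ sum-cong-≗ (λ b → cong (N p b *_) (column-sum b)) ⟨
      ∑[ b < w ] (N p b * ∑[ q < v ] N q b)
        ≡⟨ sum-cong-≗ (λ b → *-distribˡ-sum (N p b) (λ q → N q b)) ⟩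
      ∑[ b < w ] ∑[ q < v ] (N p b * N q b)    ≡⟨ ∑-comm (λ b q → N p b * N q b) ⟩
      ∑[ q < v ] rowProduct p q                ≡⟨ sum-cong-≗ (λ q → ℕ.*-identityʳ (rowProduct p q)) ⟨
      ∑[ q < v ] (rowProduct p q * 1)          ∎

  rowSum-constant : ∀ p q → rowSum p ≡ rowSum q
  rowSum-constant p q = cancel 1<k (rowSum-equation p) (rowSum-equation q)
    where
    cancel : ∀ {k x y c d} → 1 < k → k * x + c ≡ x + d → k * y + c ≡ y + d → x ≡ y
    cancel {suc k} {x} {y} {c} {d} (s≤s 0<k) ex ey =
      ℕ.*-cancelˡ-≡ x y k {{>-nonZero 0<k}}
        (ℕ.+-cancelʳ-≡ c _ _ (trans (drop x ex) (sym (drop y ey))))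
      where
      drop : ∀ z → suc k * z + c ≡ z + d → k * z + c ≡ d
      drop z e = ℕ.+-cancelˡ-≡ z _ _ (trans (sym (ℕ.+-assoc z (k * z) c)) e)

  rowSum≡k : ∀ p → rowSum p ≡ k
  rowSum≡k p = ℕ.*-cancelˡ-≡ _ _ v {{>-nonZero (ℕ.≤-<-trans z≤n k<v)}} (begin
    v * rowSum p                    ≡⟨ sum-const v (rowSum p) ⟨
    ∑[ q < v ] rowSum p             ≡⟨ sum-cong-≗ (rowSum-constant p) ⟩
    ∑[ q < v ] rowSum q             ≡⟨ ∑-comm N ⟩
    ∑[ b < w ] ∑[ q < v ] N q b     ≡⟨ sum-cong-≗ column-sum ⟩
    ∑[ b < w ] k                    ≡⟨ sum-const w k ⟩
    w * k                           ≡⟨ cong (_* k) square ⟩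
    v * k                           ∎)

  point : Fin v
  point = subst Fin (ℕ.suc-pred v {{>-nonZero (ℕ.≤-<-trans z≤n k<v)}}) zero

  parameters : k * k + λ′ ≡ k + v * λ′
  parameters = subst (λ r → k * r + λ′ ≡ r + v * λ′) (rowSum≡k point) (rowSum-equation point)

  λ<k : λ′ < k
  λ<k = ℕ.*-cancelˡ-≤ k {{>-nonZero (ℕ.<-trans z<s 1<k)}}
    (ℕ.+-cancelʳ-≤ λ′ _ _ (ℕ.≤-trans bound (ℕ.≤-reflexive (sym parameters))))
    where
    bound : k * suc λ′ + λ′ ≤ k + v * λ′
    bound = ℕ.≤-trans (ℕ.≤-reflexive (rearranged k λ′)) (ℕ.+-monoʳ-≤ k (ℕ.*-monoˡ-≤ λ′ k<v))
      where
      rearranged : ∀ k l → k * suc l + l ≡ k + suc k * l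
      rearranged = solve-∀

  sum-over-column : (b : Fin w) (f : Fin w → ℕ) →
    ∑[ q < v ] (N q b * ∑[ c < w ] (N q c * f c)) ≡ ∑[ c < w ] (columnProduct b c * f c)
  sum-over-column b f = begin
    ∑[ q < v ] (N q b * ∑[ c < w ] (N q c * f c))
      ≡⟨ sum-cong-≗ (λ q → *-distribˡ-sum (N q b) (λ c → N q c * f c)) ⟩
    ∑[ q < v ] ∑[ c < w ] (N q b * (N q c * f c))
      ≡⟨ ∑-comm (λ q c → N q b * (N q c * f c)) ⟩
    ∑[ c < w ] ∑[ q < v ] (N q b * (N q c * f c))
      ≡⟨ sum-cong-≗ (λ c → sum-cong-≗ (λ q → sym (ℕ.*-assoc (N q b) (N q c) (f c)))) ⟩
    ∑[ c < w ] ∑[ q < v ] (N q b * N q c * f c)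
      ≡⟨ sum-cong-≗ (λ c → *-distribʳ-sum (f c) (λ q → N q b * N q c)) ⟨
    ∑[ c < w ] (columnProduct b c * f c) ∎

  sum-columnProducts : ∀ b → ∑[ c < w ] columnProduct b c ≡ k * k
  sum-columnProducts b = begin
    ∑[ c < w ] columnProduct b c           ≡⟨ ∑-comm (λ c q → N q b * N q c) ⟩
    ∑[ q < v ] ∑[ c < w ] (N q b * N q c)  ≡⟨ sum-cong-≗ (λ q → *-distribˡ-sum (N q b) (N q)) ⟨
    ∑[ q < v ] (N q b * rowSum q)          ≡⟨ sum-cong-≗ (λ q → cong (N q b *_) (rowSum≡k q)) ⟩
    ∑[ q < v ] (N q b * k)                 ≡⟨ *-distribʳ-sum k (λ q → N q b) ⟨
    ∑[ q < v ] N q b * k                   ≡⟨ cong (_* k) (column-sum b) ⟩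
    k * k                                  ∎

  sum-rowProducts : ∀ q b →
    ∑[ p < v ] (rowProduct q p * N p b) + λ′ * N q b ≡ k * N q b + λ′ * k
  sum-rowProducts q b = trans
    (sum-constantOff (rowProduct q) (λ p → N p b) q (λ p p≢q → row-products (≢-sym p≢q)))
    (cong₂ _+_ (cong (_* N q b) (trans (rowProduct-diagonal q) (rowSum≡k q)))
               (cong (λ′ *_) (column-sum b)))

  sum-squared-columnProducts : ∀ b →
    ∑[ c < w ] (columnProduct b c * columnProduct b c) + λ′ * k ≡ k * k + λ′ * k * k
  sum-squared-columnProducts b = begin
    ∑[ c < w ] (columnProduct b c * columnProduct b c) + λ′ * k
      ≡⟨ cong₂ _+_ (trans (sym (sum-over-column b (columnProduct b))) (sum-cong-≗ inner))
           (trans (cong (λ′ *_) (sym (columnProduct-diagonal b)))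
                  (*-distribˡ-sum λ′ (λ q → N q b * N q b))) ⟩
    ∑[ q < v ] (N q b * R q) + ∑[ q < v ] (λ′ * (N q b * N q b))
      ≡⟨ ∑-distrib-+ (λ q → N q b * R q) (λ q → λ′ * (N q b * N q b)) ⟨
    ∑[ q < v ] (N q b * R q + λ′ * (N q b * N q b))
      ≡⟨ sum-cong-≗ term ⟩
    ∑[ q < v ] (N q b * (k + λ′ * k))
      ≡⟨ *-distribʳ-sum (k + λ′ * k) (λ q → N q b) ⟨
    ∑[ q < v ] N q b * (k + λ′ * k)
      ≡⟨ cong (_* (k + λ′ * k)) (column-sum b) ⟩
    k * (k + λ′ * k)
      ≡⟨ expand k λ′ ⟩
    k * k + λ′ * k * k ∎
    where
    R : Fin v → ℕ
    R q = ∑[ p < v ] (rowProduct q p * N p b)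
    expand : ∀ k l → k * (k + l * k) ≡ k * k + l * k * k
    expand = solve-∀
    inner : ∀ q → N q b * ∑[ c < w ] (N q c * columnProduct b c) ≡ N q b * R q
    inner q = cong (N q b *_) (begin
      ∑[ c < w ] (N q c * columnProduct b c)
        ≡⟨ sum-cong-≗ (λ c → *-distribˡ-sum (N q c) (λ p → N p b * N p c)) ⟩
      ∑[ c < w ] ∑[ p < v ] (N q c * (N p b * N p c))
        ≡⟨ ∑-comm (λ c p → N q c * (N p b * N p c)) ⟩
      ∑[ p < v ] ∑[ c < w ] (N q c * (N p b * N p c))
        ≡⟨ sum-cong-≗ (λ p → sum-cong-≗ (λ c → permuted (N q c) (N p b) (N p c))) ⟩
      ∑[ p < v ] ∑[ c < w ] (N q c * N p c * N p b)
        ≡⟨ sum-cong-≗ (λ p → *-distribʳ-sum (N p b) (λ c → N q c * N p c)) ⟨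
      R q ∎)
      where
      permuted : ∀ x y z → x * (y * z) ≡ x * z * y
      permuted = solve-∀
    term : ∀ q → N q b * R q + λ′ * (N q b * N q b) ≡ N q b * (k + λ′ * k)
    term q = begin
      N q b * R q + λ′ * (N q b * N q b)   ≡⟨ factored (N q b) (R q) λ′ ⟩
      N q b * (R q + λ′ * N q b)           ≡⟨ cong (N q b *_) (sum-rowProducts q b) ⟩
      N q b * (k * N q b + λ′ * k)         ≡⟨ unfactored (N q b) k (λ′ * k) ⟩
      k * (N q b * N q b) + N q b * (λ′ * k)
        ≡⟨ cong (λ x → k * x + N q b * (λ′ * k)) (idempotent q b) ⟩
      k * N q b + N q b * (λ′ * k)         ≡⟨ refactored (N q b) k (λ′ * k) ⟩
      N q b * (k + λ′ * k)                 ∎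
      where
      factored : ∀ x r l → x * r + l * (x * x) ≡ x * (r + l * x)
      factored = solve-∀
      unfactored : ∀ x k m → x * (k * x + m) ≡ k * (x * x) + x * m
      unfactored = solve-∀
      refactored : ∀ x k m → k * x + x * m ≡ x * (k + m)
      refactored = solve-∀

  deviation² : Fin w → Fin w → ℕ
  deviation² b c = ∣ columnProduct b c - λ′ ∣ * ∣ columnProduct b c - λ′ ∣

  -- The total squared deviation of the column products from λ′ is (k - λ′)²,
  -- which is the contribution of b alone.
  sum-deviation² : ∀ b → ∑[ c < w ] deviation² b c ≡ deviation² b b
  sum-deviation² b = ℕ.+-cancelʳ-≡ (2 * k * λ′) _ _ (trans total (sym own))
    where
    μ : Fin w → ℕ
    μ = columnProduct b
    own : deviation² b b + 2 * k * λ′ ≡ k * k + λ′ * λ′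
    own = subst (λ x → ∣ x - λ′ ∣ * ∣ x - λ′ ∣ + 2 * k * λ′ ≡ k * k + λ′ * λ′)
      (sym (columnProduct-diagonal b)) (∣m-n∣²+2mn k λ′)
    expanded : ∑[ c < w ] deviation² b c + 2 * (k * k) * λ′ ≡ ∑[ c < w ] (μ c * μ c) + v * (λ′ * λ′)
    expanded = begin
      ∑[ c < w ] deviation² b c + 2 * (k * k) * λ′
        ≡⟨ cong (λ x → ∑[ c < w ] deviation² b c + 2 * x * λ′) (sum-columnProducts b) ⟨
      ∑[ c < w ] deviation² b c + 2 * sum μ * λ′
        ≡⟨ cong (∑[ c < w ] deviation² b c +_)
             (trans (cong (_* λ′) (*-distribˡ-sum 2 μ)) (*-distribʳ-sum λ′ (λ c → 2 * μ c))) ⟩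
      ∑[ c < w ] deviation² b c + ∑[ c < w ] (2 * μ c * λ′)
        ≡⟨ ∑-distrib-+ (deviation² b) (λ c → 2 * μ c * λ′) ⟨
      ∑[ c < w ] (deviation² b c + 2 * μ c * λ′)
        ≡⟨ sum-cong-≗ (λ c → ∣m-n∣²+2mn (μ c) λ′) ⟩
      ∑[ c < w ] (μ c * μ c + λ′ * λ′)
        ≡⟨ ∑-distrib-+ (λ c → μ c * μ c) (λ _ → λ′ * λ′) ⟩
      ∑[ c < w ] (μ c * μ c) + ∑[ c < w ] (λ′ * λ′)
        ≡⟨ cong (∑[ c < w ] (μ c * μ c) +_)
             (trans (sum-const w (λ′ * λ′)) (cong (_* (λ′ * λ′)) square)) ⟩
      ∑[ c < w ] (μ c * μ c) + v * (λ′ * λ′) ∎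
    total : ∑[ c < w ] deviation² b c + 2 * k * λ′ ≡ k * k + λ′ * λ′
    total = combined k λ′ v (∑[ c < w ] deviation² b c) (∑[ c < w ] (μ c * μ c))
      expanded (sum-squared-columnProducts b) parameters
      where
      combined : ∀ k l v d s → d + 2 * (k * k) * l ≡ s + v * (l * l) →
        s + l * k ≡ k * k + l * k * k → k * k + l ≡ k + v * l → d + 2 * k * l ≡ k * k + l * l
      combined k l v d s e₁ e₂ e₃ = ℕ.+-cancelʳ-≡ (2 * (k * k) * l) _ _ (begin
        d + 2 * k * l + 2 * (k * k) * l     ≡⟨ step₁ d k l ⟩
        d + 2 * (k * k) * l + 2 * k * l     ≡⟨ cong (_+ 2 * k * l) e₁ ⟩
        s + v * (l * l) + 2 * k * l         ≡⟨ step₂ s v l k ⟩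
        (s + l * k) + (k + v * l) * l       ≡⟨ cong₂ (λ x y → x + y * l) e₂ (sym e₃) ⟩
        k * k + l * k * k + (k * k + l) * l ≡⟨ step₃ k l ⟩
        k * k + l * l + 2 * (k * k) * l     ∎)
        where
        step₁ : ∀ d k l → d + 2 * k * l + 2 * (k * k) * l ≡ d + 2 * (k * k) * l + 2 * k * l
        step₁ = solve-∀
        step₂ : ∀ s v l k → s + v * (l * l) + 2 * k * l ≡ (s + l * k) + (k + v * l) * l
        step₂ = solve-∀
        step₃ : ∀ k l → k * k + l * k * k + (k * k + l) * l ≡ k * k + l * l + 2 * (k * k) * l
        step₃ = solve-∀

  column-products : ∀ {b c} → c ≢ b → columnProduct b c ≡ λ′
  column-products {b} {c} c≢b = ℕ.∣m-n∣≡0⇒m≡n (square≡0 _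
    (sum≡term⇒others≡0 (deviation² b) (sum-deviation² b) c≢b))
    where
    square≡0 : ∀ x → x * x ≡ 0 → x ≡ 0
    square≡0 zero _ = refl

  -- A function on columns is recovered from its sums along the rows.
  recovery : (b : Fin w) (f : Fin w → ℕ) →
    ∑[ q < v ] (N q b * ∑[ c < w ] (N q c * f c)) + λ′ * f b ≡ k * f b + λ′ * sum f
  recovery b f = begin
    ∑[ q < v ] (N q b * ∑[ c < w ] (N q c * f c)) + λ′ * f b
      ≡⟨ cong (_+ λ′ * f b) (sum-over-column b f) ⟩
    ∑[ c < w ] (columnProduct b c * f c) + λ′ * f b
      ≡⟨ sum-constantOff (columnProduct b) f b (λ c → column-products) ⟩
    columnProduct b b * f b + λ′ * sum f
      ≡⟨ cong (λ x → x * f b + λ′ * sum f) (columnProduct-diagonal b) ⟩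
    k * f b + λ′ * sum f ∎

  recovery-unique : (b c : Fin w) (f g : Fin w → ℕ) → sum f ≡ sum g →
    ∑[ q < v ] (N q b * ∑[ d < w ] (N q d * f d)) ≡ ∑[ q < v ] (N q c * ∑[ d < w ] (N q d * g d)) →
    f b ≡ g c
  recovery-unique b c f g total rows =
    cancel (trans (recovery b f) (cong (λ s → k * f b + λ′ * s) total))
           (subst (λ s → s + λ′ * g c ≡ k * g c + λ′ * sum g) (sym rows) (recovery c g))
    where
    cancel : ∀ {a x y s} → a + λ′ * x ≡ k * x + λ′ * s → a + λ′ * y ≡ k * y + λ′ * s → x ≡ y
    cancel {a} {x} {y} {s} ex ey =
      ℕ.*-cancelˡ-≡ x y (k ∸ λ′) {{>-nonZero (ℕ.m<n⇒0<n∸m λ<k)}}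
        (ℕ.+-cancelʳ-≡ (λ′ * s) _ _ (trans (sym (drop x ex)) (drop y ey)))
      where
      drop : ∀ z → a + λ′ * z ≡ k * z + λ′ * s → a ≡ (k ∸ λ′) * z + λ′ * s
      drop z e = ℕ.+-cancelʳ-≡ (λ′ * z) _ _ (begin
        a + λ′ * z                             ≡⟨ e ⟩
        k * z + λ′ * s                         ≡⟨ cong (λ j → j * z + λ′ * s) (ℕ.m∸n+n≡m (ℕ.<⇒≤ λ<k)) ⟨
        (k ∸ λ′ + λ′) * z + λ′ * s             ≡⟨ distributed (k ∸ λ′) λ′ z s ⟩
        (k ∸ λ′) * z + λ′ * s + λ′ * z         ∎)
        where
        distributed : ∀ n l z s → (n + l) * z + l * s ≡ n * z + l * s + l * z
        distributed = solve-∀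

  constant-on-entries : (f : Fin v → Fin w → ℕ) (x y : ℕ) →
    (∀ p → ∑[ b < w ] (N p b * f p b) ≡ x) →
    (∀ {p q} → p ≢ q → ∑[ b < w ] (N q b * f p b) ≡ y) →
    (∀ p q → sum (f p) ≡ sum (f q)) →
    ∀ {p b q c} → N p b ≡ N q c → f p b ≡ f q c
  constant-on-entries f x y diagonal off total {p} {b} {q} {c} eq =
    recovery-unique b c (f p) (f q) (total p q)
      (ℕ.+-cancelʳ-≡ (y * N p b) _ _ (begin
        along p b + y * N p b  ≡⟨ evaluated p b ⟩
        x * N p b + y * k      ≡⟨ cong (λ i → x * i + y * k) eq ⟩
        x * N q c + y * k      ≡⟨ evaluated q c ⟨
        along q c + y * N q c  ≡⟨ cong (λ i → along q c + y * i) eq ⟨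
        along q c + y * N p b  ∎))
    where
    along : Fin v → Fin w → ℕ
    along p b = ∑[ q < v ] (N q b * ∑[ d < w ] (N q d * f p d))
    evaluated : ∀ p b → along p b + y * N p b ≡ x * N p b + y * k
    evaluated p b = begin
      along p b + y * N p b
        ≡⟨ cong (_+ y * N p b) (sum-cong-≗ (λ q → ℕ.*-comm (N q b) _)) ⟩
      ∑[ q < v ] (∑[ d < w ] (N q d * f p d) * N q b) + y * N p b
        ≡⟨ sum-constantOff (λ q → ∑[ d < w ] (N q d * f p d)) (λ q → N q b) p
             (λ q q≢p → off (≢-sym q≢p)) ⟩
      ∑[ d < w ] (N p d * f p d) * N p b + y * ∑[ q < v ] N q b
        ≡⟨ cong₂ (λ s t → s * N p b + y * t) (diagonal p) (column-sum b) ⟩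
      x * N p b + y * k ∎

  constant-off-diagonal : (f : Fin w → Fin w → ℕ) (x y : ℕ) →
    (∀ p b → ∑[ d < w ] (N p d * f b d) + y * N p b ≡ y + x * N p b) →
    (∀ b c → sum (f b) ≡ sum (f c)) →
    ∀ {b c b′ c′} → b ≢ c → b′ ≢ c′ → f b c ≡ f b′ c′
  constant-off-diagonal f x y rows total {b} {c} {b′} {c′} b≢c b′≢c′ =
    recovery-unique c c′ (f b) (f b′) (total b b′)
      (ℕ.+-cancelʳ-≡ (y * λ′) _ _ (trans (evaluated b≢c) (sym (evaluated b′≢c′))))
    where
    along : Fin w → Fin w → ℕ
    along b c = ∑[ q < v ] (N q c * ∑[ d < w ] (N q d * f b d))
    evaluated : ∀ {b c} → b ≢ c → along b c + y * λ′ ≡ y * k + x * λ′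
    evaluated {b} {c} b≢c = begin
      along b c + y * λ′
        ≡⟨ cong (λ i → along b c + y * i) (column-products b≢c) ⟨
      along b c + y * columnProduct c b
        ≡⟨ cong (along b c +_) (*-distribˡ-sum y (λ q → N q c * N q b)) ⟩
      along b c + ∑[ q < v ] (y * (N q c * N q b))
        ≡⟨ ∑-distrib-+ (λ q → N q c * ∑[ d < w ] (N q d * f b d)) (λ q → y * (N q c * N q b)) ⟨
      ∑[ q < v ] (N q c * ∑[ d < w ] (N q d * f b d) + y * (N q c * N q b))
        ≡⟨ sum-cong-≗ (λ q → trans (factored (N q c) _ y (N q b))
             (trans (cong (N q c *_) (rows q b)) (distributed (N q c) y x (N q b)))) ⟩
      ∑[ q < v ] (y * N q c + x * (N q c * N q b))
        ≡⟨ ∑-distrib-+ (λ q → y * N q c) (λ q → x * (N q c * N q b)) ⟩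
      ∑[ q < v ] (y * N q c) + ∑[ q < v ] (x * (N q c * N q b))
        ≡⟨ cong₂ _+_ (*-distribˡ-sum y (λ q → N q c)) (*-distribˡ-sum x (λ q → N q c * N q b)) ⟨
      y * ∑[ q < v ] N q c + x * columnProduct c b
        ≡⟨ cong₂ (λ s t → y * s + x * t) (column-sum c) (column-products b≢c) ⟩
      y * k + x * λ′ ∎
      where
      factored : ∀ m s y n → m * s + y * (m * n) ≡ m * (s + y * n)
      factored = solve-∀
      distributed : ∀ m y x n → m * (y + x * n) ≡ y * m + x * (m * n)
      distributed = solve-∀

-- Invariant functions separating orbits

merge : ℕ → ℕ → ℕ → ℕ
merge i j n = if does (n ℕ.≟ j) then i else n

merge-hit : ∀ {i j n} → n ≡ j → merge i j n ≡ i
merge-hit {j = j} {n} n≡j rewrite dec-true (n ℕ.≟ j) n≡j = refl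

merge-miss : ∀ {i j n} → n ≢ j → merge i j n ≡ n
merge-miss {j = j} {n} n≢j rewrite dec-false (n ℕ.≟ j) n≢j = refl

merge-source : ∀ i j → merge i j i ≡ i
merge-source i j with does (i ℕ.≟ j)
... | true  = refl
... | false = refl

-- Union-find: each pair in the list merges two labels.
separating-labels : {X E : Set} {_~_ : Rel X ℓ} → IsEquivalence _~_ →
  (label : X → ℕ) → (∀ {x y} → label x ≡ label y → x ~ y) →
  (src tgt : E → X) → (∀ e → src e ~ tgt e) → (es : List E) →
  Σ[ f ∈ (X → ℕ) ] (∀ {x y} → f x ≡ f y → x ~ y) × (∀ {e} → e ∈ˡ es → f (src e) ≡ f (tgt e))
separating-labels equiv label separates src tgt related [] = label , separates , λ ()
separating-labels {X = X} {_~_ = _~_} equiv label separates src tgt related (e ∷ es)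
  with f , f-separates , f-merges ← separating-labels equiv label separates src tgt related es
  = merged , merged-separates , merged-merges
  where
  open IsEquivalence equiv using () renaming (sym to ~-sym; trans to ~-trans)
  merged : X → ℕ
  merged x = merge (f (src e)) (f (tgt e)) (f x)
  merged-separates : ∀ {x y} → merged x ≡ merged y → x ~ y
  merged-separates {x} {y} eq with f x ℕ.≟ f (tgt e) | f y ℕ.≟ f (tgt e)
  ... | yes p | yes q = f-separates (trans p (sym q))
  ... | yes p | no  q = ~-trans (f-separates p) (~-trans (~-sym (related e))
    (f-separates (trans (sym (merge-hit p)) (trans eq (merge-miss q)))))
  ... | no  p | yes q = ~-trans (f-separates (trans (sym (merge-miss p)) (trans eq (merge-hit q))))
    (~-trans (related e) (~-sym (f-separates q)))
  ... | no  p | no  q = f-separates (trans (sym (merge-miss p)) (trans eq (merge-miss q)))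
  merged-merges : ∀ {e′} → e′ ∈ˡ e ∷ es → merged (src e′) ≡ merged (tgt e′)
  merged-merges (here refl) =
    trans (merge-source (f (src e)) (f (tgt e))) (sym (merge-hit {n = f (tgt e)} refl))
  merged-merges (there i)   = cong (merge (f (src e)) (f (tgt e))) (f-merges i)

injective⇒surjective : (f : Fin n → Fin n) → (∀ {i j} → f i ≡ f j → i ≡ j) → ∀ j → ∃[ i ] f i ≡ j
injective⇒surjective {suc n} f injective j with any? (λ i → f i ≟ j)
... | yes preimage = preimage
... | no  none = contradiction
  (λ {i} {i′} eq → injective (punchOut-injective (avoids i) (avoids i′) eq))
  (<⇒notInjective (ℕ.n<1+n n))
  where
  avoids : ∀ i → j ≢ f i
  avoids i j≡fi = none (i , sym j≡fi)

surjective⇒injective : (f : Fin n → Fin n) → (∀ j → ∃[ i ] f i ≡ j) → ∀ {i j} → f i ≡ f j → i ≡ j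
surjective⇒injective f surjective {i} {j} eq =
  trans (sym (section-f i)) (trans (cong (proj₁ ∘ surjective) eq) (section-f j))
  where
  section-injective : ∀ {i j} → proj₁ (surjective i) ≡ proj₁ (surjective j) → i ≡ j
  section-injective {i} {j} e =
    trans (sym (proj₂ (surjective i))) (trans (cong f e) (proj₂ (surjective j)))
  section-f : ∀ i → proj₁ (surjective (f i)) ≡ i
  section-f i with injective⇒surjective (proj₁ ∘ surjective) section-injective i
  ... | j , refl = cong (proj₁ ∘ surjective) (proj₂ (surjective j))

module _ (D : Design) where
  open Design D
  open Automorphism
  open Group (Aut D) using (ε; _∙_; _⁻¹)

  record Action (n : ℕ) : Set where
    field
      perm      : Automorphism D → Permutation′ n
      ε-acts    : ∀ x → perm ε ⟨$⟩ʳ x ≡ x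
      ∙-acts    : ∀ α β x → perm (α ∙ β) ⟨$⟩ʳ x ≡ perm α ⟨$⟩ʳ (perm β ⟨$⟩ʳ x)
      ⁻¹-acts   : ∀ α x → perm (α ⁻¹) ⟨$⟩ʳ (perm α ⟨$⟩ʳ x) ≡ x

    act : Automorphism D → Fin n → Fin n
    act α x = perm α ⟨$⟩ʳ x

    undo : ∀ α {x y} → act α x ≡ y → act (α ⁻¹) y ≡ x
    undo α {x} refl = ⁻¹-acts α x

  pointAction : Action #points
  pointAction = record
    { perm    = onPoints
    ; ε-acts  = λ _ → refl
    ; ∙-acts  = λ _ _ _ → refl
    ; ⁻¹-acts = λ α _ → Perm.inverseˡ (onPoints α)
    }

  blockAction : Action #blocks
  blockAction = record
    { perm    = onBlocks
    ; ε-acts  = λ _ → refl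
    ; ∙-acts  = λ _ _ _ → refl
    ; ⁻¹-acts = λ α _ → Perm.inverseˡ (onBlocks α)
    }

  module _ {G : Pred (Automorphism D) ℓ} (subgroup : IsSubgroup (Aut D) G) where
    open IsSubgroup subgroup

    module Pairs (𝒳 : Action m) (𝒴 : Action n) where
      open Action 𝒳 using () renaming (act to actX)
      open Action 𝒴 using () renaming (act to actY)
      private
        module X = Action 𝒳
        module Y = Action 𝒴

      Orbit : Rel (Fin m × Fin n) ℓ
      Orbit (x , y) (x′ , y′) = ∃[ α ] α ∈ G × actX α x ≡ x′ × actY α y ≡ y′

      orbit-isEquivalence : IsEquivalence Orbit
      orbit-isEquivalence = record
        { refl  = λ {(x , y)} → ε , ε-closed , X.ε-acts x , Y.ε-acts y
        ; sym   = λ (α , α∈G , αx , αy) → α ⁻¹ , ⁻¹-closed α∈G , X.undo α αx , Y.undo α αy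
        ; trans = λ {(x , y)} (α , α∈G , αx , αy) (β , β∈G , βx , βy) →
            β ∙ α , ∙-closed β∈G α∈G
            , trans (X.∙-acts β α x) (trans (cong (actX β) αx) βx)
            , trans (Y.∙-acts β α y) (trans (cong (actY β) αy) βy)
        }

      open IsEquivalence orbit-isEquivalence public using ()
        renaming (refl to orbit-refl; reflexive to orbit-reflexive; sym to orbit-sym; trans to orbit-trans)

      -- G need not be decidable, so its orbits are approximated from inside by
      -- those of the group generated by a finite family γ of its elements.
      invariant-separating-orbits : {J : Set} (γ : J → Automorphism D) → (∀ j → γ j ∈ G) →
        (js : List J) → (∀ j → j ∈ˡ js) →
        Σ[ f ∈ (Fin m → Fin n → ℕ) ] (∀ j x y → f (actX (γ j) x) (actY (γ j) y) ≡ f x y) ×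
               (∀ {x y x′ y′} → f x y ≡ f x′ y′ → Orbit (x , y) (x′ , y′))
      invariant-separating-orbits γ γ∈G js all-js
        with f , separates , merges ← separating-labels orbit-isEquivalence
          (λ (x , y) → toℕ (combine x y))
          (λ {(x , y)} {(x′ , y′)} eq →
            orbit-reflexive (×-≡,≡→≡ (combine-injective x y x′ y′ (toℕ-injective eq))))
          proj₂ (λ (j , x , y) → actX (γ j) x , actY (γ j) y)
          (λ (j , x , y) → γ j , γ∈G j , refl , refl)
          (cartesianProduct js (cartesianProduct (allFin m) (allFin n)))
        = (λ x y → f (x , y))
        , (λ j x y → sym (merges {j , x , y} (∈-cartesianProduct⁺ (all-js j)
                                   (∈-cartesianProduct⁺ (∈-allFin x) (∈-allFin y)))))
        , separates

      induced : Pred (Automorphism D) ℓ′ → Pred (Permutation′ n) ℓ′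
      induced K π = ∃[ α ] α ∈ K × Y.perm α Perm.≈ π

      induced-stabiliser-orbit : ∀ x {y y′} →
        SameOrbit (induced (λ α → α ∈ G × actX α x ≡ x)) y y′ ⇔ Orbit (x , y) (x , y′)
      induced-stabiliser-orbit x {y} = mk⇔
        (λ (π , (α , (α∈G , αx) , α≈π) , πy) → α , α∈G , αx , trans (α≈π y) πy)
        (λ (α , α∈G , αx , αy) → Y.perm α , (α , (α∈G , αx) , λ _ → refl) , αy)

      module Classes {r : ℕ} (R : Fin r → REL (Fin m) (Fin n) 0ℓ)
        (classify  : ∀ x y → ∃[ i ] R i x y)
        (disjoint  : ∀ {i j x y} → R i x y → R j x y → i ≡ j)
        (invariant : ∀ {i x y} α → R i x y → R i (actX α x) (actY α y))
        (nonempty  : ∀ i → ∃₂ (R i))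
        (transitive : ∀ x x′ → ∃[ α ] α ∈ G × actX α x ≡ x′)
        (H : Fin m → Pred (Permutation′ n) ℓ)
        (H-orbit : ∀ x {y y′} → SameOrbit (H x) y y′ ⇔ Orbit (x , y) (x , y′))
        where

        class : Fin m → Fin n → Fin r
        class x y = proj₁ (classify x y)

        move : ∀ {i x x′ y} → R i x y → ∃[ y′ ] R i x′ y′ × Orbit (x , y) (x′ , y′)
        move {x = x} {x′} {y} Rxy with α , α∈G , refl ← transitive x x′ =
          actY α y , invariant α Rxy , α , α∈G , refl , refl

        orbit-class : ∀ {i x y x′ y′} → Orbit (x , y) (x′ , y′) → R i x y → R i x′ y′
        orbit-class (α , _ , refl , refl) = invariant α

        transitive⇒orbits : (∀ i → TransitiveOnPairs D G actX actY (R i)) →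
          ∀ x → HasOrbits (H x) r
        transitive⇒orbits transitiveOn x = record
          { rep          = rep
          ; rep-distinct = λ {i} {j} i≢j same → i≢j
              (disjoint (orbit-class (Equivalence.to (H-orbit x) same) (rep-class i)) (rep-class j))
          ; rep-covers   = λ y → class x y
              , Equivalence.from (H-orbit x)
                  (transitiveOn (class x y) (rep-class (class x y)) (proj₂ (classify x y)))
          }
          where
          rep : Fin r → Fin n
          rep i = proj₁ (move {x′ = x} (proj₂ (proj₂ (nonempty i))))
          rep-class : ∀ i → R i x (rep i)
          rep-class i = proj₁ (proj₂ (move (proj₂ (proj₂ (nonempty i)))))

        -- Each of the r nonempty classes contains an orbit, so if there are
        -- only r orbits then the classes are the orbits.
        orbits⇒transitive : (∀ x → HasOrbits (H x) r) →
          ∀ i → TransitiveOnPairs D G actX actY (R i)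
        orbits⇒transitive orbits i {x} {y} {x′} {y′} Rxy Rx′y′
          with z , Rx′z , xy~x′z ← move {x′ = x′} Rxy
          with j , j~z ← HasOrbits.rep-covers (orbits x′) z
             | k , k~y′ ← HasOrbits.rep-covers (orbits x′) y′
          = orbit-trans xy~x′z (orbit-trans (orbit-sym (reach j~z))
              (subst (λ l → Orbit (x′ , rep l) (x′ , y′)) (sym j≡k) (reach k~y′)))
          where
          open HasOrbits (orbits x′)
          reach : ∀ {y y′} → SameOrbit (H x′) y y′ → Orbit (x′ , y) (x′ , y′)
          reach = Equivalence.to (H-orbit x′)
          rep-in : ∀ {i l y} → SameOrbit (H x′) (rep l) y → R i x′ y → class x′ (rep l) ≡ i
          rep-in l~y Ry =
            disjoint (proj₂ (classify x′ _)) (orbit-class (orbit-sym (reach l~y)) Ry)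
          every-class : ∀ i → ∃[ l ] class x′ (rep l) ≡ i
          every-class i with u , Ru , _ ← move {x′ = x′} (proj₂ (proj₂ (nonempty i)))
            with l , l~u ← rep-covers u = l , rep-in l~u Ru
          j≡k : j ≡ k
          j≡k = surjective⇒injective (class x′ ∘ rep) every-class
            (trans (rep-in j~z Rx′z) (sym (rep-in k~y′ Rx′y′)))

-- Designs

0<#⇒∃ : {P : Pred (Fin n) ℓ} (P? : Decidable P) → 0 < # P? → ∃ P
0<#⇒∃ {n = n} P? 0<# with any? P?
... | yes witness = witness
... | no  none    = contradiction (begin
  # P?                          ≡⟨ #≡sum P? ⟩
  ∑[ i < n ] indicator (P? i)   ≡⟨ sum-cong-≗ (λ i → indicator-false (P? i) (none ∘ (i ,_))) ⟩
  ∑[ i < n ] 0                  ≡⟨ sum-const n 0 ⟩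
  n * 0                         ≡⟨ ℕ.*-zeroʳ n ⟩
  0                             ∎) (ℕ.m<n⇒n≢0 0<#)
  where open ≡-Reasoning

#<n⇒∃¬ : {P : Pred (Fin n) ℓ} (P? : Decidable P) → # P? < n → ∃[ i ] ¬ P i
#<n⇒∃¬ {n = n} P? #<n with any? (¬? ∘ P?)
... | yes witness = witness
... | no  none    = contradiction (begin
  # P?                          ≡⟨ #≡sum P? ⟩
  ∑[ i < n ] indicator (P? i)
    ≡⟨ sum-cong-≗ (λ i → indicator-true (P? i) (decidable-stable (P? i) (none ∘ (i ,_)))) ⟩
  ∑[ i < n ] 1                  ≡⟨ sum-const n 1 ⟩
  n * 1                         ≡⟨ ℕ.*-identityʳ n ⟩
  n                             ∎) (ℕ.<⇒≢ #<n)
  where open ≡-Reasoning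

another : 1 < n → (i : Fin n) → ∃[ j ] i ≢ j
another {suc (suc n)} _ zero    = 1F , λ ()
another {suc (suc n)} _ (suc i) = zero , λ ()
another {suc zero} (s≤s ()) _

module Structure (D : Design) {v k λ′ : ℕ}
  (is2Design : Is2Design D v k λ′) (nonTrivial : NonTrivial v k) where
  open Design D
  open Is2Design is2Design
  open Automorphism

  k<#points : k < #points
  k<#points = subst (k <_) (sym points-count) (proj₂ nonTrivial)

  1<k : 1 < k
  1<k = ℕ.<-trans (ℕ.n<1+n 1) (proj₁ nonTrivial)

  anotherPoint : ∀ p → ∃[ q ] p ≢ q
  anotherPoint = another (ℕ.<-trans 1<k k<#points)

  point-on : ∀ b → ∃[ p ] p I b
  point-on b = 0<#⇒∃ (_I? b) (subst (0 <_) (sym (block-size b)) (ℕ.<-trans z<s 1<k))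

  point-off : ∀ b → ∃[ p ] ¬ p I b
  point-off b = #<n⇒∃¬ (_I? b) (subst (_< #points) (sym (block-size b)) k<#points)

  block-through : ∀ {p q} → p ≢ q → ∃[ b ] p I b × q I b
  block-through {p} {q} p≢q =
    0<#⇒∃ (λ b → (p I? b) ×-dec (q I? b)) (subst (0 <_) (sym (blocks-through p≢q)) λ-positive)

  intersecting? : ∀ b c → Dec (Intersecting b c)
  intersecting? b c = any? (λ p → (p I? b) ×-dec (p I? c))

  ¬intersecting⇒≢ : ∀ {b c} → ¬ Intersecting b c → b ≢ c
  ¬intersecting⇒≢ {b} ¬bc refl with p , pIb ← point-on b = ¬bc (p , pIb , pIb)

  neighbour : ∀ b → ∃[ c ] b ≢ c × Intersecting b c
  neighbour b
    with p , pIb ← point-on b | q , ¬qIb ← point-off b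
    with c , pIc , qIc ← block-through (λ { refl → ¬qIb pIb })
    = c , (λ { refl → ¬qIb qIc }) , p , pIb , pIc

  somePoint : Point
  somePoint = subst Fin (ℕ.suc-pred #points {{>-nonZero (ℕ.≤-<-trans z≤n k<#points)}}) zero

  someBlock : Block
  someBlock = proj₁ (block-through (proj₂ (anotherPoint somePoint)))

  intersecting-image : ∀ (α : Automorphism D) {b c} →
    Intersecting b c → Intersecting (actB α b) (actB α c)
  intersecting-image α {b} {c} (p , pIb , pIc) =
    actP α p , Equivalence.to (preserves α p b) pIb , Equivalence.to (preserves α p c) pIc

  N : Point → Block → ℕ
  N p b = indicator (p I? b)

  N-invariant : ∀ (α : Automorphism D) p b → N p b ≡ N (actP α p) (actB α b)
  N-invariant α p b = indicator-cong (p I? b) (actP α p I? actB α b) (preserves α p b)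

  module _ {G : Pred (Automorphism D) ℓ} (subgroup : IsSubgroup (Aut D) G) where
    open IsSubgroup subgroup
    open Group (Aut D) using (ε; _⁻¹)

    module PB = Pairs D subgroup (pointAction D) (blockAction D)
    module BP = Pairs D subgroup (blockAction D) (pointAction D)
    module BB = Pairs D subgroup (blockAction D) (blockAction D)

    PointTransitive BlockTransitive : Set _
    PointTransitive = ∀ p q → ∃[ α ] α ∈ G × actP α p ≡ q
    BlockTransitive = ∀ b c → ∃[ α ] α ∈ G × actB α b ≡ c

    incidence : Fin 2 → REL Point Block 0ℓ
    incidence 0F = _I_
    incidence 1F p b = ¬ p I b

    incidence-classify : ∀ p b → ∃[ i ] incidence i p b
    incidence-classify p b with p I? b
    ... | yes pIb = 0F , pIb
    ... | no ¬pIb = 1F , ¬pIb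

    incidence-disjoint : ∀ {i j p b} → incidence i p b → incidence j p b → i ≡ j
    incidence-disjoint {0F} {0F} _ _ = refl
    incidence-disjoint {0F} {1F} pIb ¬pIb = contradiction pIb ¬pIb
    incidence-disjoint {1F} {0F} ¬pIb pIb = contradiction pIb ¬pIb
    incidence-disjoint {1F} {1F} _ _ = refl

    incidence-invariant : ∀ {i p b} (α : Automorphism D) →
      incidence i p b → incidence i (actP α p) (actB α b)
    incidence-invariant {0F} {p} {b} α = Equivalence.to (preserves α p b)
    incidence-invariant {1F} {p} {b} α ¬pIb = ¬pIb ∘ Equivalence.from (preserves α p b)

    incidence-nonempty : ∀ i → ∃₂ (incidence i)
    incidence-nonempty 0F with p , pIb ← point-on someBlock = p , someBlock , pIb
    incidence-nonempty 1F with p , ¬pIb ← point-off someBlock = p , someBlock , ¬pIb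

    flipped-nonempty : ∀ i → ∃₂ (flip (incidence i))
    flipped-nonempty i with p , b , Rpb ← incidence-nonempty i = b , p , Rpb

    module Flags (transitive : PointTransitive) = PB.Classes incidence incidence-classify
      (λ {i} → incidence-disjoint {i}) (λ {i} → incidence-invariant {i}) incidence-nonempty transitive
      (λ p → inducedOnBlocks D (stabiliserOfPoint D G p)) PB.induced-stabiliser-orbit

    module DualFlags (transitive : BlockTransitive) = BP.Classes (λ i → flip (incidence i))
      (flip incidence-classify) (λ {i} → incidence-disjoint {i}) (λ {i} → incidence-invariant {i})
      flipped-nonempty transitive
      (λ b → inducedOnPoints D (stabiliserOfBlock D G b)) BP.induced-stabiliser-orbit

    meeting : Fin 3 → Rel Block 0ℓ
    meeting 0F = _≡_
    meeting 1F b c = b ≢ c × Intersecting b c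
    meeting 2F b c = ¬ Intersecting b c

    meeting-classify : ∀ b c → ∃[ i ] meeting i b c
    meeting-classify b c with b ≟ c | intersecting? b c
    ... | yes b≡c | _      = 0F , b≡c
    ... | no  b≢c | yes bc = 1F , b≢c , bc
    ... | no  b≢c | no ¬bc = 2F , ¬bc

    meeting-disjoint : ∀ {i j b c} → meeting i b c → meeting j b c → i ≡ j
    meeting-disjoint {0F} {0F} _ _ = refl
    meeting-disjoint {0F} {1F} b≡c (b≢c , _) = contradiction b≡c b≢c
    meeting-disjoint {0F} {2F} b≡c ¬bc = contradiction b≡c (¬intersecting⇒≢ ¬bc)
    meeting-disjoint {1F} {0F} (b≢c , _) b≡c = contradiction b≡c b≢c
    meeting-disjoint {1F} {1F} _ _ = refl
    meeting-disjoint {1F} {2F} (_ , bc) ¬bc = contradiction bc ¬bc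
    meeting-disjoint {2F} {0F} ¬bc b≡c = contradiction b≡c (¬intersecting⇒≢ ¬bc)
    meeting-disjoint {2F} {1F} ¬bc (_ , bc) = contradiction bc ¬bc
    meeting-disjoint {2F} {2F} _ _ = refl

    meeting-invariant : ∀ {i b c} (α : Automorphism D) →
      meeting i b c → meeting i (actB α b) (actB α c)
    meeting-invariant {0F} α b≡c = cong (actB α) b≡c
    meeting-invariant {1F} {_} {c} α (b≢c , bc) =
      (λ αb≡αc → b≢c (trans (sym (undo α αb≡αc)) (⁻¹-acts α c))) , intersecting-image α bc
      where open Action (blockAction D)
    meeting-invariant {2F} α ¬bc (p , pIαb , pIαc) =
      ¬bc (subst₂ Intersecting (Perm.inverseˡ (onBlocks α)) (Perm.inverseˡ (onBlocks α))
        (intersecting-image (α ⁻¹) (p , pIαb , pIαc)))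

    meeting-nonempty : (∃[ b ] ∃[ c ] ¬ Intersecting b c) → ∀ i → ∃₂ (meeting i)
    meeting-nonempty _ 0F = someBlock , someBlock , refl
    meeting-nonempty _ 1F = someBlock , neighbour someBlock
    meeting-nonempty disjointPair 2F = disjointPair

    blockStabiliser-orbit : ∀ b {c c′} →
      SameOrbit (PointStabiliser (inducedOnBlocks D G) b) c c′ ⇔ BB.Orbit (b , c) (b , c′)
    blockStabiliser-orbit b {c} = mk⇔
      (λ (π , ((α , α∈G , α≈π) , πb) , πc) → α , α∈G , trans (α≈π b) πb , trans (α≈π c) πc)
      (λ (α , α∈G , αb , αc) → onBlocks α , ((α , α∈G , λ _ → refl) , αb) , αc)

    module Meetings (disjointPair : ∃[ b ] ∃[ c ] ¬ Intersecting b c) (transitive : BlockTransitive) =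
      BB.Classes meeting meeting-classify (λ {i} → meeting-disjoint {i}) (λ {i} → meeting-invariant {i})
        (meeting-nonempty disjointPair) transitive
        (PointStabiliser (inducedOnBlocks D G)) blockStabiliser-orbit

    2-transitive⇒onPoints : ConditionA D G → TransitiveOnPairs D G actP actP _≢_
    2-transitive⇒onPoints two {x} {y} x≢y x′≢y′ with π , (α , α∈G , α≈π) , πx , πy ← two x≢y x′≢y′ =
      α , α∈G , trans (α≈π x) πx , trans (α≈π y) πy

    2-transitive⇒onBlocks : 2-Transitive (inducedOnBlocks D G) → TransitiveOnPairs D G actB actB _≢_
    2-transitive⇒onBlocks two {x} {y} x≢y x′≢y′ with π , (α , α∈G , α≈π) , πx , πy ← two x≢y x′≢y′ =
      α , α∈G , trans (α≈π x) πx , trans (α≈π y) πy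

    onPoints⇒2-transitive : TransitiveOnPairs D G actP actP _≢_ → ConditionA D G
    onPoints⇒2-transitive two x≢y x′≢y′ with α , α∈G , αx , αy ← two x≢y x′≢y′ =
      onPoints α , (α , α∈G , λ _ → refl) , αx , αy

    onBlocks⇒2-transitive : TransitiveOnPairs D G actB actB _≢_ → 2-Transitive (inducedOnBlocks D G)
    onBlocks⇒2-transitive two x≢y x′≢y′ with α , α∈G , αx , αy ← two x≢y x′≢y′ =
      onBlocks α , (α , α∈G , λ _ → refl) , αx , αy

    pairs⇒pointTransitive : TransitiveOnPairs D G actP actP _≢_ → PointTransitive
    pairs⇒pointTransitive two p q with p ≟ q
    ... | yes refl = ε , ε-closed , refl
    ... | no  p≢q with α , α∈G , αp , _ ← two p≢q (≢-sym p≢q) = α , α∈G , αp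

    pairs⇒blockTransitive : TransitiveOnPairs D G actB actB _≢_ → BlockTransitive
    pairs⇒blockTransitive two b c with b ≟ c
    ... | yes refl = ε , ε-closed , refl
    ... | no  b≢c with α , α∈G , αb , _ ← two b≢c (≢-sym b≢c) = α , α∈G , αb

    conditionA⇒pointTransitive : ConditionA D G → PointTransitive
    conditionA⇒pointTransitive a = pairs⇒pointTransitive (2-transitive⇒onPoints a)

    rank⇒blockTransitive : ∀ {r} → HasRank (inducedOnBlocks D G) r → BlockTransitive
    rank⇒blockTransitive (transitive , _) b c
      with π , (α , α∈G , α≈π) , πb ← transitive b c = α , α∈G , trans (α≈π b) πb

    conditionB⇒blockTransitive : ConditionB D G → BlockTransitive
    conditionB⇒blockTransitive (inj₁ two) = pairs⇒blockTransitive (2-transitive⇒onBlocks two)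
    conditionB⇒blockTransitive (inj₂ (rank , _)) = rank⇒blockTransitive rank

    flags⇒blockTransitive : TransitiveOnPairs D G actP actB _I_ → BlockTransitive
    flags⇒blockTransitive flags b c
      with α , α∈G , _ , αb ← flags (proj₂ (point-on b)) (proj₂ (point-on c)) = α , α∈G , αb

    conditionB⇒onMeetings : ConditionB D G →
      TransitiveOnPairs D G actB actB (meeting 1F) × TransitiveOnPairs D G actB actB (meeting 2F)
    conditionB⇒onMeetings (inj₁ two) =
      (λ (b≢c , _) (b′≢c′ , _) → 2-transitive⇒onBlocks two b≢c b′≢c′) ,
      (λ ¬bc ¬b′c′ → 2-transitive⇒onBlocks two (¬intersecting⇒≢ ¬bc) (¬intersecting⇒≢ ¬b′c′))
    conditionB⇒onMeetings (inj₂ (rank@(_ , orbits) , disjointPair)) =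
      orbits⇒transitive orbits 1F , orbits⇒transitive orbits 2F
      where open Meetings disjointPair (rank⇒blockTransitive rank)

    pairwiseTransitive⇒conditionA : PairwiseTransitive D G → ConditionA D G
    pairwiseTransitive⇒conditionA pt = onPoints⇒2-transitive (PairwiseTransitive.distinctPoints pt)

    pairwiseTransitive⇒blockTransitive : PairwiseTransitive D G → BlockTransitive
    pairwiseTransitive⇒blockTransitive pt = flags⇒blockTransitive (PairwiseTransitive.incidentPairs pt)

    pairwiseTransitive⇒conditionB : PairwiseTransitive D G → ConditionB D G
    pairwiseTransitive⇒conditionB pt with any? (λ b → any? (λ c → ¬? (intersecting? b c)))
    ... | no none = inj₁ (onBlocks⇒2-transitive
          (λ b≢c b′≢c′ → intersectingBlocks (b≢c , allMeet _ _) (b′≢c′ , allMeet _ _)))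
      where
      open PairwiseTransitive pt
      allMeet : ∀ b c → Intersecting b c
      allMeet b c = decidable-stable (intersecting? b c) (λ ¬bc → none (b , c , ¬bc))
    ... | yes disjointPair =
      inj₂ ((transitive , Meetings.transitive⇒orbits disjointPair moves onMeeting) , disjointPair)
      where
      open PairwiseTransitive pt
      moves : BlockTransitive
      moves = pairwiseTransitive⇒blockTransitive pt
      transitive : Transitive (inducedOnBlocks D G)
      transitive b c with α , α∈G , αb ← moves b c = onBlocks α , (α , α∈G , λ _ → refl) , αb
      onMeeting : ∀ i → TransitiveOnPairs D G actB actB (meeting i)
      onMeeting 0F {b} {_} {b′} refl refl with α , α∈G , αb ← moves b b′ = α , α∈G , αb , αb
      onMeeting 1F = intersectingBlocks
      onMeeting 2F = nonIntersectingBlocks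

    onIncidence : PairwiseTransitive D G → ∀ i → TransitiveOnPairs D G actP actB (incidence i)
    onIncidence pt 0F = PairwiseTransitive.incidentPairs pt
    onIncidence pt 1F = PairwiseTransitive.nonIncidentPairs pt

    onIncidence⁻ : ConditionA D G → ConditionB D G →
      (∀ i → TransitiveOnPairs D G actP actB (incidence i)) → PairwiseTransitive D G
    onIncidence⁻ a b pairs = record
      { distinctPoints        = 2-transitive⇒onPoints a
      ; incidentPairs         = pairs 0F
      ; nonIncidentPairs      = pairs 1F
      ; intersectingBlocks    = proj₁ (conditionB⇒onMeetings b)
      ; nonIntersectingBlocks = proj₂ (conditionB⇒onMeetings b)
      }

    transpose : {R : REL Point Block 0ℓ} →
      TransitiveOnPairs D G actP actB R → TransitiveOnPairs D G actB actP (flip R)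
    transpose pairs Rpb Rp′b′ with α , α∈G , αp , αb ← pairs Rpb Rp′b′ = α , α∈G , αb , αp

    untranspose : {R : REL Point Block 0ℓ} →
      TransitiveOnPairs D G actB actP (flip R) → TransitiveOnPairs D G actP actB R
    untranspose pairs Rpb Rp′b′ with α , α∈G , αb , αp ← pairs Rpb Rp′b′ = α , α∈G , αp , αb

    pairwiseTransitive⇔ABC :
      PairwiseTransitive D G ⇔ (ConditionA D G × ConditionB D G × ConditionC D G)
    pairwiseTransitive⇔ABC = mk⇔ to from
      where
      to : PairwiseTransitive D G → ConditionA D G × ConditionB D G × ConditionC D G
      to pt = pairwiseTransitive⇒conditionA pt , pairwiseTransitive⇒conditionB pt ,
        Flags.transitive⇒orbits (pairs⇒pointTransitive (PairwiseTransitive.distinctPoints pt))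
          (onIncidence pt)
      from : ConditionA D G × ConditionB D G × ConditionC D G → PairwiseTransitive D G
      from (a , b , c) = onIncidence⁻ a b (Flags.orbits⇒transitive (conditionA⇒pointTransitive a) c)

    pairwiseTransitive⇔ABD :
      PairwiseTransitive D G ⇔ (ConditionA D G × ConditionB D G × ConditionD D G)
    pairwiseTransitive⇔ABD = mk⇔ to from
      where
      to : PairwiseTransitive D G → ConditionA D G × ConditionB D G × ConditionD D G
      to pt = pairwiseTransitive⇒conditionA pt , pairwiseTransitive⇒conditionB pt ,
        DualFlags.transitive⇒orbits (pairwiseTransitive⇒blockTransitive pt)
          (λ i → transpose {incidence i} (onIncidence pt i))
      from : ConditionA D G × ConditionB D G × ConditionD D G → PairwiseTransitive D G
      from (a , b , d) = onIncidence⁻ a b (λ i → untranspose {incidence i}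
        (DualFlags.orbits⇒transitive (conditionB⇒blockTransitive b) d i))

  N-idempotent : ∀ p b → N p b * N p b ≡ N p b
  N-idempotent p b with does (p I? b)
  ... | true  = refl
  ... | false = refl

  N-column-sum : ∀ b → ∑[ p < #points ] N p b ≡ k
  N-column-sum b = trans (sym (#≡sum (_I? b))) (block-size b)

  N-row-products : ∀ {p q} → p ≢ q → ∑[ b < #blocks ] (N p b * N q b) ≡ λ′
  N-row-products {p} {q} p≢q = trans (sum-cong-≗ (λ b → sym (indicator-× (p I? b) (q I? b))))
    (trans (sym (#≡sum (λ b → (p I? b) ×-dec (q I? b)))) (blocks-through p≢q))

  flag-entry : ∀ {p b} → p I b → N p b ≡ 1
  flag-entry {p} {b} = indicator-true (p I? b)

  antiflag-entry : ∀ {p b} → ¬ p I b → N p b ≡ 0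
  antiflag-entry {p} {b} = indicator-false (p I? b)

  module InvariantFunctions (symmetric : #blocks ≡ #points)
    {J : Set} (γ : J → Automorphism D)
    (2-transitive : ∀ {x y x′ y′} → x ≢ y → x′ ≢ y′ →
      ∃[ j ] actP (γ j) x ≡ x′ × actP (γ j) y ≡ y′)
    where

    open SquareIncidence N N-idempotent N-column-sum N-row-products symmetric 1<k k<#points

    invariant⇒constant : (f : Point → ℕ) → (∀ j p → f (actP (γ j) p) ≡ f p) → ∀ p q → f p ≡ f q
    invariant⇒constant f invariant p q
      with j , γp≡q , _ ← 2-transitive (proj₂ (anotherPoint p)) (proj₂ (anotherPoint q)) =
      trans (sym (invariant j p)) (cong f γp≡q)

    invariant⇒constantOff : (f : Point → Point → ℕ) →
      (∀ j p q → f (actP (γ j) p) (actP (γ j) q) ≡ f p q) →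
      ∀ {p q p′ q′} → p ≢ q → p′ ≢ q′ → f p q ≡ f p′ q′
    invariant⇒constantOff f invariant {p} {q} p≢q p′≢q′
      with j , γp≡p′ , γq≡q′ ← 2-transitive p≢q p′≢q′ =
      trans (sym (invariant j p q)) (cong₂ f γp≡p′ γq≡q′)

    invariant⇒flagConstant : (f : Point → Block → ℕ) →
      (∀ j p b → f (actP (γ j) p) (actB (γ j) b) ≡ f p b) →
      ∀ {p b q c} → N p b ≡ N q c → f p b ≡ f q c
    invariant⇒flagConstant f invariant = constant-on-entries f _ _
      (λ p → invariant⇒constant (λ p → F p p) (λ j p → F-invariant j p p) p somePoint)
      (λ p≢q → invariant⇒constantOff F F-invariant p≢q (proj₂ (anotherPoint somePoint)))
      (invariant⇒constant (λ p → sum (f p)) (λ j p →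
        trans (∑-permute (f (actP (γ j) p)) (onBlocks (γ j))) (sum-cong-≗ (invariant j p))))
      where
      F : Point → Point → ℕ
      F p q = ∑[ b < #blocks ] (N q b * f p b)
      F-invariant : ∀ j p q → F (actP (γ j) p) (actP (γ j) q) ≡ F p q
      F-invariant j p q = trans
        (∑-permute (λ b → N (actP (γ j) q) b * f (actP (γ j) p) b) (onBlocks (γ j)))
        (sum-cong-≗ (λ b → cong₂ _*_ (sym (N-invariant (γ j) q b)) (invariant j p b)))

    invariant⇒blocksConstant : (f : Block → Block → ℕ) →
      (∀ j b c → f (actB (γ j) b) (actB (γ j) c) ≡ f b c) →
      ∀ {b c b′ c′} → b ≢ c → b′ ≢ c′ → f b c ≡ f b′ c′
    invariant⇒blocksConstant f invariant = constant-off-diagonal f x y rows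
      (λ b c → invariant⇒flagConstant (λ _ b → sum (f b))
        (λ j _ b → trans (∑-permute (f (actB (γ j) b)) (onBlocks (γ j))) (sum-cong-≗ (invariant j b)))
        (trans (flag-entry (proj₂ (point-on b))) (sym (flag-entry (proj₂ (point-on c))))))
      where
      row : Point → Block → ℕ
      row p b = ∑[ d < #blocks ] (N p d * f b d)
      row-constant : ∀ {p b q c} → N p b ≡ N q c → row p b ≡ row q c
      row-constant = invariant⇒flagConstant row (λ j p b → trans
        (∑-permute (λ d → N (actP (γ j) p) d * f (actB (γ j) b) d) (onBlocks (γ j)))
        (sum-cong-≗ (λ d → cong₂ _*_ (sym (N-invariant (γ j) p d)) (invariant j b d))))
      x y : ℕ
      x = row (proj₁ (point-on someBlock)) someBlock
      y = row (proj₁ (point-off someBlock)) someBlock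
      rows : ∀ p b → row p b + y * N p b ≡ y + x * N p b
      rows p b with p I? b
      ... | yes pIb = trans (cong₂ _+_
            (row-constant (trans (flag-entry pIb) (sym (flag-entry (proj₂ (point-on someBlock))))))
            (ℕ.*-identityʳ y))
          (trans (ℕ.+-comm x y) (cong (y +_) (sym (ℕ.*-identityʳ x))))
      ... | no ¬pIb = cong₂ _+_
            (row-constant (trans (antiflag-entry ¬pIb) (sym (antiflag-entry (proj₂ (point-off someBlock))))))
            (trans (ℕ.*-zeroʳ y) (sym (ℕ.*-zeroʳ x)))

  module _ {G : Pred (Automorphism D) ℓ} (subgroup : IsSubgroup (Aut D) G) where
    open IsSubgroup subgroup
    open Group (Aut D) using (ε)

    private
      Quadruple : Set
      Quadruple = (Point × Point) × (Point × Point)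

      quadruples : List Quadruple
      quadruples = cartesianProduct pairs pairs
        where pairs = cartesianProduct (allFin #points) (allFin #points)

      ∈-quadruples : ∀ quadruple → quadruple ∈ˡ quadruples
      ∈-quadruples ((x , y) , x′ , y′) = ∈-cartesianProduct⁺
        (∈-cartesianProduct⁺ (∈-allFin x) (∈-allFin y))
        (∈-cartesianProduct⁺ (∈-allFin x′) (∈-allFin y′))

    choose : TransitiveOnPairs D G actP actP _≢_ → (((x , y) , x′ , y′) : Quadruple) →
      ∃[ α ] α ∈ G × (x ≢ y → x′ ≢ y′ → actP α x ≡ x′ × actP α y ≡ y′)
    choose two ((x , y) , x′ , y′) with x ≟ y | x′ ≟ y′
    ... | yes x≡y | _ = ε , ε-closed , λ x≢y _ → contradiction x≡y x≢y
    ... | no _ | yes x′≡y′ = ε , ε-closed , λ _ x′≢y′ → contradiction x′≡y′ x′≢y′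
    ... | no x≢y | no x′≢y′ with α , α∈G , αxy ← two x≢y x′≢y′ = α , α∈G , λ _ _ → αxy

    symmetric⇒pairwiseTransitive : #blocks ≡ #points → ConditionA D G → PairwiseTransitive D G
    symmetric⇒pairwiseTransitive symmetric a = record
      { distinctPoints        = two
      ; incidentPairs         = λ pIb qIc → onFlags (trans (flag-entry pIb) (sym (flag-entry qIc)))
      ; nonIncidentPairs      = λ ¬pIb ¬qIc →
          onFlags (trans (antiflag-entry ¬pIb) (sym (antiflag-entry ¬qIc)))
      ; intersectingBlocks    = λ (b≢c , _) (b′≢c′ , _) → onBlockPairs b≢c b′≢c′
      ; nonIntersectingBlocks = λ ¬bc ¬b′c′ →
          onBlockPairs (¬intersecting⇒≢ ¬bc) (¬intersecting⇒≢ ¬b′c′)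
      }
      where
      two : TransitiveOnPairs D G actP actP _≢_
      two = 2-transitive⇒onPoints subgroup a
      γ : Quadruple → Automorphism D
      γ j = proj₁ (choose two j)
      γ∈G : ∀ j → γ j ∈ G
      γ∈G j = proj₁ (proj₂ (choose two j))
      γ-2-transitive : ∀ {x y x′ y′} → x ≢ y → x′ ≢ y′ → ∃[ j ] actP (γ j) x ≡ x′ × actP (γ j) y ≡ y′
      γ-2-transitive {x} {y} {x′} {y′} x≢y x′≢y′ = j , proj₂ (proj₂ (choose two j)) x≢y x′≢y′
        where j = (x , y) , x′ , y′
      open InvariantFunctions symmetric γ γ-2-transitive
      onFlags : ∀ {p b q c} → N p b ≡ N q c → PB.Orbit subgroup (p , b) (q , c)
      onFlags with f , invariant , separates ←
        PB.invariant-separating-orbits subgroup γ γ∈G quadruples ∈-quadruples =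
        separates ∘ invariant⇒flagConstant f invariant
      onBlockPairs : TransitiveOnPairs D G actB actB _≢_
      onBlockPairs b≢c b′≢c′ with f , invariant , separates ←
        BB.invariant-separating-orbits subgroup γ γ∈G quadruples ∈-quadruples =
        separates (invariant⇒blocksConstant f invariant b≢c b′≢c′)

lemma2p3 : ∀ {ℓ : Level} (D : Design) (v k λ′ : ℕ) →
    Is2Design D v k λ′ → NonTrivial v k →
    (G : Pred (Automorphism D) ℓ) → IsSubgroup (Aut D) G →
    ((PairwiseTransitive D G ⇔ (ConditionA D G × ConditionB D G × ConditionC D G))
    × (PairwiseTransitive D G ⇔ (ConditionA D G × ConditionB D G × ConditionD D G)))
    × (Symmetric D v →
    (PairwiseTransitive D G ⇔ 2-Transitive (inducedOnPoints D G)))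
lemma2p3 D v k λ′ is2Design nonTrivial G subgroup =
  (pairwiseTransitive⇔ABC subgroup , pairwiseTransitive⇔ABD subgroup) ,
  λ #blocks≡v → mk⇔ (pairwiseTransitive⇒conditionA subgroup)
    (symmetric⇒pairwiseTransitive subgroup (trans #blocks≡v (sym (Is2Design.points-count is2Design))))
  where open Structure D is2Design nonTrivial
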